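{- Let $x,y\in B$ with $|x|=|y|$, $\delta(x)=3$ and $\delta(y)=1$. Then $s([x]_2)<s([y]_2)$.
   Context: Stern's sequence $(a(n))_{n\ge0}$: $a(0)=0$, $a(1)=1$, $a(2n)=a(n)$, $a(2n+1)=a(n)+a(n+1)$; $s(n)=a(n+1)$. For a binary string $x$, $[x]_2$ is the integer it represents in base 2 and $|x|$ its length. $B$ denotes the set of nonempty binary strings that are concatenations of blocks each equal to $10$ or $100$; for $x\in B$, $\delta(x)$ is the number of $0$s minus the number of $1$s in $x$, which equals the number of $100$ blocks. -}

module Defs where

open import Data.Digit using (Bit; 0b; 1b; fromDigits)
open import Data.Fin.Properties using (_≟_)
open import Data.Integer.Base using (ℤ; _⊖_)
open import Data.List.Base using (List; []; _∷_; concat; length; filter; reverse)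
open import Data.List.Relation.Unary.All using (All)
open import Data.Nat.Base
open import Data.Nat.DivMod using (m*n%n≡0; [m+kn]%n≡m%n)
open import Data.Nat.Induction using (<-wellFounded)
open import Data.Nat.Properties using (⌊n/2⌋<n; ⌈n/2⌉<n; +-comm; +-identityʳ; *-comm; n≡⌊n+n/2⌋; n≡⌈n+n/2⌉)
open import Data.Product.Base using (∃-syntax; _×_)
open import Induction.WellFounded using (Acc; acc)
open import Relation.Binary.PropositionalEquality

-- Well-founded form of Stern's recurrence: for n ≥ 2 the value at n is read
-- off at ⌊n/2⌋ (n even), or at ⌊n/2⌋ and ⌈n/2⌉ (n odd).  The defining equations
-- a(0)=0, a(1)=1, a(2n)=a(n), a(2n+1)=a(n)+a(n+1) are a-zero, …, a-odd below.
sternAcc : (n : ℕ) → Acc _<_ n → ℕ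
sternAcc 0 _ = 0
sternAcc 1 _ = 1
sternAcc n@(suc (suc m)) (acc rs) with n % 2
... | zero  = sternAcc ⌊ n /2⌋ (rs (⌊n/2⌋<n (suc m)))
... | suc _ = sternAcc ⌊ n /2⌋ (rs (⌊n/2⌋<n (suc m)))
            + sternAcc ⌈ n /2⌉ (rs (⌈n/2⌉<n m))

a : ℕ → ℕ
a n = sternAcc n (<-wellFounded n)

sternAcc-irr : ∀ n (p q : Acc _<_ n) → sternAcc n p ≡ sternAcc n q
sternAcc-irr 0 _ _ = refl
sternAcc-irr 1 _ _ = refl
sternAcc-irr n@(suc (suc m)) (acc rs) (acc rs′) with n % 2
... | zero  = sternAcc-irr ⌊ n /2⌋ _ _
... | suc _ = cong₂ _+_ (sternAcc-irr ⌊ n /2⌋ (rs (⌊n/2⌋<n (suc m))) _)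
                        (sternAcc-irr ⌈ n /2⌉ (rs (⌈n/2⌉<n m)) _)

sternAcc-even : ∀ n (p : Acc _<_ n) → n % 2 ≡ 0 → sternAcc n p ≡ a ⌊ n /2⌋
sternAcc-even 0 _ _ = refl
sternAcc-even n@(suc (suc m)) (acc rs) eq with n % 2
... | zero = sternAcc-irr ⌊ n /2⌋ _ _

sternAcc-odd : ∀ n (p : Acc _<_ n) → n % 2 ≡ 1 →
               sternAcc n p ≡ a ⌊ n /2⌋ + a ⌈ n /2⌉
sternAcc-odd 1 _ _ = refl
sternAcc-odd n@(suc (suc m)) (acc rs) eq with n % 2
... | suc _ = cong₂ _+_ (sternAcc-irr ⌊ n /2⌋ (rs (⌊n/2⌋<n (suc m))) _)
                        (sternAcc-irr ⌈ n /2⌉ (rs (⌈n/2⌉<n m)) _)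

a-zero : a 0 ≡ 0
a-zero = refl

a-one : a 1 ≡ 1
a-one = refl

2*n≡n+n : ∀ n → 2 * n ≡ n + n
2*n≡n+n n = cong (n +_) (+-identityʳ n)

a-even : ∀ n → a (2 * n) ≡ a n
a-even n = trans
  (sternAcc-even (2 * n) (<-wellFounded (2 * n))
    (trans (cong (_% 2) (*-comm 2 n)) (m*n%n≡0 n 2)))
  (cong a (trans (cong ⌊_/2⌋ (2*n≡n+n n)) (sym (n≡⌊n+n/2⌋ n))))

a-odd : ∀ n → a (2 * n + 1) ≡ a n + a (n + 1)
a-odd n = trans
  (sternAcc-odd (2 * n + 1) (<-wellFounded (2 * n + 1))
    (trans (cong (_% 2) (trans (+-comm (2 * n) 1) (cong suc (*-comm 2 n))))
           ([m+kn]%n≡m%n 1 n 2)))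
  (cong₂ (λ i j → a i + a j)
    (trans (cong ⌊_/2⌋ eq) (sym (n≡⌈n+n/2⌉ n)))
    (trans (cong ⌈_/2⌉ eq)
      (trans (cong suc (sym (n≡⌊n+n/2⌋ n))) (+-comm 1 n))))
  where
  eq : 2 * n + 1 ≡ suc (n + n)
  eq = trans (+-comm (2 * n) 1) (cong suc (2*n≡n+n n))

s : ℕ → ℕ
s n = a (n + 1)

-- Written in reading order, most significant bit first.
BinaryString : Set
BinaryString = List Bit

-- fromDigits expects the least significant digit first.
[_]₂ : BinaryString → ℕ
[ x ]₂ = fromDigits {2} (reverse x)

data Block : BinaryString → Set where
  block10  : Block (1b ∷ 0b ∷ [])
  block100 : Block (1b ∷ 0b ∷ 0b ∷ [])

B : BinaryString → Set
B x = x ≢ [] × ∃[ bs ] (All Block bs × concat bs ≡ x)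

δ : BinaryString → ℤ
δ x = length (filter (_≟ 0b) x) ⊖ length (filter (_≟ 1b) x)

{-# OPTIONS --safe #-}
-- Reading a bit updates (a(n), a(n+1)) = (p , q) linearly: 0 gives (p , p+q) and
-- 1 gives (p+q , q).  A block 10 is therefore two Fibonacci steps, while a block
-- 100 falls short of three Fibonacci steps by F(n) q, where n is the number of
-- bits still to be read.  With N = |x| = |y|, the one loss in y is small enough
-- that s(y) ≥ F(N) + F(N-2).  In x, each of the blocks 100 except the last one
-- costs a factor of at least 11/12, so 144 s(x) ≤ 121 F(N+1), which is less than
-- 144 (F(N) + F(N-2)) as soon as N ≥ 9.
module Submission where

open import Defs
open import Data.Digit using (0b; 1b; fromDigits)
open import Data.Fin.Patterns using (0F; 1F)
open import Data.Fin.Properties using (_≟_)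
open import Data.Integer.Base using (+_)
open import Data.Integer.Properties using (⊖-≥; +-injective)
open import Data.List.Base using ([]; _∷_; concat; length; filter; reverseAcc)
open import Data.List.Relation.Unary.All using (All; []; _∷_)
open import Data.Nat.Base using (ℕ; zero; suc; _+_; _*_; _^_; _∸_; _≤_; _<_; z≤n; s≤s)
open import Data.Nat.Properties hiding (_≟_)
open import Data.Nat.Tactic.RingSolver using (solve-∀)
open import Data.Product.Base using (∃-syntax; _,_)
open import Relation.Binary.PropositionalEquality using (_≡_; refl; sym; trans; cong; cong₂; subst; subst₂; module ≡-Reasoning)

-- Fibonacci numbers

fib : ℕ → ℕ
fib 0 = 0
fib 1 = 1
fib (suc (suc n)) = fib n + fib (suc n)

fib-addition : ∀ m n → fib m * fib n + fib (suc m) * fib (suc n) ≡ fib (suc m + n)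
fib-addition zero n = +-identityʳ (fib (suc n))
fib-addition (suc m) n = begin
  fib (suc m) * fib n + (fib m + fib (suc m)) * fib (suc n)
    ≡⟨ regroup (fib m) (fib (suc m)) (fib n) (fib (suc n)) ⟩
  fib m * fib (suc n) + fib (suc m) * fib (2 + n)
    ≡⟨ fib-addition m (suc n) ⟩
  fib (suc m + suc n)
    ≡⟨ cong fib (+-suc (suc m) n) ⟩
  fib (2 + m + n) ∎
  where
  open ≡-Reasoning
  regroup : ∀ u v p q → v * p + (u + v) * q ≡ u * q + v * (p + q)
  regroup = solve-∀

fib-≤-suc : ∀ n → fib n ≤ fib (suc n)
fib-≤-suc zero = z≤n
fib-≤-suc (suc n) = m≤n+m (fib (suc n)) (fib n)

-- Both sides obey the Fibonacci recurrence, so two base cases suffice. The ratio tends to the fifth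
-- power of the golden ratio, about 11.09; at `n = 2` it is 13, hence `3 ≤ n`.
fib-+5 : ∀ {n} → 3 ≤ n → fib (5 + n) ≤ 12 * fib n
fib-+5 (s≤s (s≤s (s≤s {n = n} z≤n))) = go n
  where
  go : ∀ n → fib (8 + n) ≤ 12 * fib (3 + n)
  go 0 = m≤m+n 21 3
  go 1 = m≤m+n 34 2
  go (suc (suc n)) = subst (fib (10 + n) ≤_)
    (sym (*-distribˡ-+ 12 (fib (3 + n)) (fib (4 + n))))
    (+-mono-≤ (go n) (go (suc n)))

-- The bracket on the right is a Lucas number, and 121/144 is `(11/12)^2`. Again the recurrence
-- reduces everything to two base cases.
fib-lucas : ∀ n → 121 * fib (10 + n) < 144 * (fib (9 + n) + fib (7 + n))
fib-lucas 0 = m≤m+n 6656 112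
fib-lucas 1 = m≤m+n 10770 174
fib-lucas (suc (suc n)) = subst₂ _<_
  (sym (*-distribˡ-+ 121 (fib (10 + n)) (fib (11 + n))))
  (regroup (fib (9 + n)) (fib (7 + n)) (fib (10 + n)) (fib (8 + n)))
  (+-mono-< (fib-lucas n) (fib-lucas (suc n)))
  where
  regroup : ∀ u v w z → 144 * (u + v) + 144 * (w + z) ≡ 144 * ((u + w) + (v + z))
  regroup = solve-∀

-- Evaluating Stern's sequence along a binary string

value : BinaryString → ℕ → ℕ → ℕ
value [] p q = q
value (0F ∷ x) p q = value x p (p + q)
value (1F ∷ x) p q = value x (p + q) q

-- Generalised over the prefix already read, which `acc` holds least significant bit first; the
-- empty prefix gives the pair (0 , 1).
value-reverseAcc : ∀ x acc → let n = fromDigits {2} acc in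
                   value x (a n) (a (n + 1)) ≡ s (fromDigits {2} (reverseAcc acc x))
value-reverseAcc [] acc = refl
value-reverseAcc (0F ∷ x) acc = trans
  (cong₂ (value x)
    (trans (sym (a-even n)) (cong a (*-comm 2 n)))
    (trans (sym (a-odd n)) (cong (λ k → a (k + 1)) (*-comm 2 n))))
  (value-reverseAcc x (0b ∷ acc))
  where n = fromDigits {2} acc
value-reverseAcc (1F ∷ x) acc = trans
  (cong₂ (value x)
    (trans (sym (a-odd n)) (cong a (2n+1 n)))
    (trans (sym (a-even (n + 1))) (cong a (2n+2 n))))
  (value-reverseAcc x (1b ∷ acc))
  where
  n = fromDigits {2} acc
  2n+1 : ∀ n → 2 * n + 1 ≡ 1 + n * 2
  2n+1 = solve-∀
  2n+2 : ∀ n → 2 * (n + 1) ≡ 1 + n * 2 + 1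
  2n+2 = solve-∀

s≡value : ∀ x → s [ x ]₂ ≡ value x 0 1
s≡value x = sym (value-reverseAcc x [])

-- The index counts the blocks 100.
data Blocks : ℕ → BinaryString → Set where
  []  : Blocks 0 []
  ten : ∀ {h x} → Blocks h x → Blocks h (1b ∷ 0b ∷ x)
  hundred : ∀ {h x} → Blocks h x → Blocks (suc h) (1b ∷ 0b ∷ 0b ∷ x)

concat-Blocks : ∀ {bs} → All Block bs → ∃[ h ] Blocks h (concat bs)
concat-Blocks [] = 0 , []
concat-Blocks (block10 ∷ bs) with concat-Blocks bs
... | h , w = h , ten w
concat-Blocks (block100 ∷ bs) with concat-Blocks bs
... | h , w = suc h , hundred w

zeros≡h+ones : ∀ {h x} → Blocks h x →
               length (filter (_≟ 0b) x) ≡ h + length (filter (_≟ 1b) x)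
zeros≡h+ones [] = refl
zeros≡h+ones {h} (ten w) = trans (cong suc (zeros≡h+ones w)) (sym (+-suc h _))
zeros≡h+ones {suc h} (hundred w) =
  cong suc (trans (cong suc (zeros≡h+ones w)) (sym (+-suc h _)))

δ-Blocks : ∀ {h x} → Blocks h x → δ x ≡ + h
δ-Blocks {h} {x} w rewrite zeros≡h+ones w =
  trans (⊖-≥ (m≤n+m ones h)) (cong +_ (m+n∸n≡m h ones))
  where ones = length (filter (_≟ 1b) x)

B⇒Blocks : ∀ {h x} → B x → δ x ≡ + h → Blocks h x
-- The decomposition yields some count `k` of blocks 100; computing `δ` from it forces `k` to be
-- `h`.
B⇒Blocks (_ , bs , blocks , refl) δ≡h with concat-Blocks blocks
... | k , w = subst (λ j → Blocks j (concat bs))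
                    (+-injective (trans (sym (δ-Blocks w)) δ≡h)) w

3*h≤length : ∀ {h x} → Blocks h x → h * 3 ≤ length x
3*h≤length [] = z≤n
3*h≤length (ten w) = m≤n⇒m≤o+n 2 (3*h≤length w)
3*h≤length (hundred w) = +-monoʳ-≤ 3 (3*h≤length w)

-- Bounds on the values

-- The second entry of the pair reached from (p , q) after `n` Fibonacci steps.
fibForm : ℕ → ℕ → ℕ → ℕ
fibForm n p q = fib n * p + fib (suc n) * q

fibForm-10 : ∀ n p q → fibForm n (p + q) ((p + q) + q) ≡ fibForm (2 + n) p q
fibForm-10 n p q = regroup (fib n) (fib (suc n)) p q
  where
  regroup : ∀ u v p q → u * (p + q) + v * ((p + q) + q) ≡ (u + v) * p + (v + (u + v)) * q
  regroup = solve-∀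

fibForm-100 : ∀ n p q → fibForm n (p + q) ((p + q) + ((p + q) + q)) + fib n * q
                      ≡ fibForm (3 + n) p q
fibForm-100 n p q = regroup (fib n) (fib (suc n)) p q
  where
  regroup : ∀ u v p q → u * (p + q) + v * ((p + q) + ((p + q) + q)) + u * q
                      ≡ (v + (u + v)) * p + ((u + v) + (v + (u + v))) * q
  regroup = solve-∀

-- The loss `fib n * q` is at least a twelfth of `fibForm (3 + n) p q`: by `p ≤ q` the latter is at
-- most `fib (5 + n) * q`, and `fib-+5` applies.
fibForm-100-loss : ∀ {n p q} → 3 ≤ n → p ≤ q →
  12 * fibForm n (p + q) ((p + q) + ((p + q) + q)) ≤ 11 * fibForm (3 + n) p q
fibForm-100-loss {n} {p} {q} 3≤n p≤q = +-cancelʳ-≤ (12 * (fib n * q)) _ _ (begin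
  12 * S + 12 * (fib n * q)   ≡⟨ *-distribˡ-+ 12 S (fib n * q) ⟨
  12 * (S + fib n * q)        ≡⟨ cong (12 *_) (fibForm-100 n p q) ⟩
  12 * T                      ≡⟨ +-comm T (11 * T) ⟩
  11 * T + T                  ≤⟨ +-monoʳ-≤ (11 * T) T≤ ⟩
  11 * T + 12 * (fib n * q)   ∎)
  where
  open ≤-Reasoning
  S = fibForm n (p + q) ((p + q) + ((p + q) + q))
  T = fibForm (3 + n) p q
  T≤ : T ≤ 12 * (fib n * q)
  T≤ = begin
    fib (3 + n) * p + fib (4 + n) * q ≤⟨ +-monoˡ-≤ _ (*-monoʳ-≤ (fib (3 + n)) p≤q) ⟩
    fib (3 + n) * q + fib (4 + n) * q ≡⟨ *-distribʳ-+ q (fib (3 + n)) (fib (4 + n)) ⟨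
    fib (5 + n) * q                   ≤⟨ *-monoˡ-≤ q (fib-+5 3≤n) ⟩
    12 * fib n * q                    ≡⟨ *-assoc 12 (fib n) q ⟩
    12 * (fib n * q)                  ∎

value-tens : ∀ {x} → Blocks 0 x → ∀ p q → value x p q ≡ fibForm (length x) p q
value-tens [] p q = sym (+-identityʳ q)
value-tens (ten {x = x} w) p q =
  trans (value-tens w (p + q) ((p + q) + q)) (fibForm-10 (length x) p q)

-- Induction along the string; every block restores the order `p ≤ q`. The last block 100 is not
-- charged, since too few bits may follow it.
value-upper : ∀ {h x} → Blocks (suc h) x → ∀ {p q} → p ≤ q →
              12 ^ h * value x p q ≤ 11 ^ h * fibForm (length x) p q
value-upper {h} (ten {x = x} w) {p} {q} p≤q =
  subst (λ r → 12 ^ h * value x (p + q) ((p + q) + q) ≤ 11 ^ h * r)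
        (fibForm-10 (length x) p q)
        (value-upper w (m≤m+n (p + q) q))
value-upper {zero} (hundred {x = x} w) {p} {q} p≤q = *-monoʳ-≤ 1 (begin
  value x (p + q) ((p + q) + ((p + q) + q))              ≡⟨ value-tens w _ _ ⟩
  fibForm (length x) (p + q) ((p + q) + ((p + q) + q))   ≤⟨ m≤m+n _ _ ⟩
  _                                                      ≡⟨ fibForm-100 (length x) p q ⟩
  fibForm (3 + length x) p q                             ∎)
  where open ≤-Reasoning
value-upper {suc h} (hundred {x = x} w) {p} {q} p≤q = begin
  12 * 12 ^ h * V     ≡⟨ *-assoc 12 (12 ^ h) V ⟩
  12 * (12 ^ h * V)   ≤⟨ *-monoʳ-≤ 12 (value-upper w (m≤m+n (p + q) _)) ⟩
  12 * (11 ^ h * S)   ≡⟨ swap 12 (11 ^ h) S ⟩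
  -- Another block 100 is still to come, so at least three bits remain.
  11 ^ h * (12 * S)   ≤⟨ *-monoʳ-≤ (11 ^ h) (fibForm-100-loss (m+n≤o⇒m≤o 3 (3*h≤length w)) p≤q) ⟩
  11 ^ h * (11 * T)   ≡⟨ swap (11 ^ h) 11 T ⟩
  11 * (11 ^ h * T)   ≡⟨ *-assoc 11 (11 ^ h) T ⟨
  11 * 11 ^ h * T     ∎
  where
  open ≤-Reasoning
  V = value x (p + q) ((p + q) + ((p + q) + q))
  S = fibForm (length x) (p + q) ((p + q) + ((p + q) + q))
  T = fibForm (3 + length x) p q
  swap : ∀ u v w → u * (v * w) ≡ v * (u * w)
  swap = solve-∀

-- The starting pair is the one reached from (0 , 1) after e Fibonacci steps.
value-lower : ∀ {y} → Blocks 1 y → ∀ e →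
              fib (length y + e) + fib (length y + e ∸ 2) ≤ value y (fib e) (fib (suc e))
value-lower (ten {x = y} w) e = subst₂ _≤_
  (cong (λ n → fib n + fib (n ∸ 2)) (trans (+-suc (length y) (suc e)) (cong suc (+-suc (length y) e))))
  (cong (value y (fib (2 + e))) (+-comm (fib (suc e)) _))
  (value-lower w (2 + e))
value-lower (hundred {x = y} w) e = begin
  fib (3 + j + e) + fib (1 + j + e)
    -- The value exceeds `fib (3 + j + e)` by exactly `v * (p + q)`, that is
    -- `fib (suc j) * fib (2 + e)`; the addition formula bounds this below by `fib (1 + j + e)`.
    ≤⟨ +-monoʳ-≤ (fib (3 + j + e)) split≤ ⟩
  fib (3 + j + e) + v * (p + q)
    ≡⟨ cong (_+ v * (p + q)) expand ⟩
  (u * (p + q) + v * (q + (p + q))) + v * (p + q)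
    ≡⟨ regroup u v p q ⟩
  fibForm j (p + q) ((p + q) + ((p + q) + q))
    ≡⟨ value-tens w _ _ ⟨
  value y (p + q) ((p + q) + ((p + q) + q)) ∎
  where
  open ≤-Reasoning
  j = length y
  u = fib j
  v = fib (suc j)
  p = fib e
  q = fib (suc e)
  split≤ : fib (1 + j + e) ≤ v * (p + q)
  split≤ = begin
    fib (1 + j + e)   ≡⟨ fib-addition j e ⟨
    u * p + v * q     ≤⟨ +-monoˡ-≤ (v * q) (*-monoˡ-≤ p (fib-≤-suc j)) ⟩
    v * p + v * q     ≡⟨ *-distribˡ-+ v p q ⟨
    v * (p + q)       ∎
  expand : fib (3 + j + e) ≡ u * (p + q) + v * (q + (p + q))
  expand = sym (trans (fib-addition j (2 + e))
    (cong fib (cong suc (trans (+-suc j (suc e)) (cong suc (+-suc j e))))))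
  regroup : ∀ u v p q → (u * (p + q) + v * (q + (p + q))) + v * (p + q)
                      ≡ u * (p + q) + v * ((p + q) + ((p + q) + q))
  regroup = solve-∀

fib-lucas-≤ : ∀ {n} → 9 ≤ n → 121 * fib (suc n) < 144 * (fib n + fib (n ∸ 2))
fib-lucas-≤ {n} 9≤n = subst (λ n → 121 * fib (suc n) < 144 * (fib n + fib (n ∸ 2)))
  (m+[n∸m]≡n 9≤n) (fib-lucas (n ∸ 9))

value-< : ∀ {x y} → Blocks 3 x → Blocks 1 y → length x ≡ length y →
          value x 0 1 < value y 0 1
value-< {x} {y} wx wy |x|≡|y| = *-cancelˡ-< 144 _ _ (begin-strict
  -- Two of the three blocks 100 are charged, giving `12 ^ 2` and `11 ^ 2`; the three blocks also
  -- give length at least 9 for the strict step.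
  144 * value x 0 1             ≤⟨ value-upper wx z≤n ⟩
  121 * fibForm n 0 1           ≡⟨ cong (121 *_) (cong₂ _+_ (*-zeroʳ (fib n)) (*-identityʳ (fib (suc n)))) ⟩
  121 * fib (suc n)             <⟨ fib-lucas-≤ (3*h≤length wx) ⟩
  144 * (fib n + fib (n ∸ 2))   ≡⟨ cong (λ k → 144 * (fib k + fib (k ∸ 2))) (trans |x|≡|y| (sym (+-identityʳ _))) ⟩
  144 * (fib (length y + 0) + fib (length y + 0 ∸ 2))
                                ≤⟨ *-monoʳ-≤ 144 (value-lower wy 0) ⟩
  144 * value y 0 1             ∎)
  where
  open ≤-Reasoning
  n = length x

mainTheorem12 : (x y : BinaryString) → B x → B y → length x ≡ length y → δ x ≡ + 3 → δ y ≡ + 1 → s [ x ]₂ < s [ y ]₂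
mainTheorem12 x y Bx By |x|≡|y| δx≡3 δy≡1 = subst₂ _<_
  (sym (s≡value x)) (sym (s≡value y))
  (value-< (B⇒Blocks Bx δx≡3) (B⇒Blocks By δy≡1) |x|≡|y|)
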